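{- Let $\Sigma$ be a finite alphabet of non-negative integer letters containing the letter $0$, and let $m,n$ be positive integers. Consider the following algorithm. (1) Start with the word $w=0^n$. (2) Append to the end of the current word $w$ the lexicographically largest word $x\in\Sigma^m$ such that the suffix of length $n$ of the new word $wx$ has not yet appeared as a factor at a modulo $m$ position in the current word $w$. (3) Repeat step (2) until no word $x\in\Sigma^m$ satisfying the condition exists. Then the word $w$ obtained when the algorithm stops is an $m$-shift de Bruijn sequence of order $n$ over $\Sigma$.
   Context: $\Sigma^n$ denotes the set of all words of length $n$ over $\Sigma$, and $0^n$ is the word of $n$ zeros. Letters are ordered as integers, so $0$ is the smallest letter, and words of the same length are compared lexicographically. For a word $w=a_1a_2\cdots a_\ell$, write $w[i..j]=a_i\cdots a_j$. A word $u$ of length $n$ appears in $w$ (as a factor) at a modulo $m$ position if $u=w[im+1..im+n]$ for some integer $i\ge 0$; distinct values of $i$ count as distinct appearances. An $m$-shift de Bruijn sequence of order $n$ over $\Sigma$ is a word $w$ over $\Sigma$, of length $m|\Sigma|^n+(n-m)$, such that each word in $\Sigma^n$ appears exactly once in $w$ as a factor at a modulo $m$ position. -}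

module Defs where

open import Data.List using (List; _++_; length; take; drop; replicate)
open import Data.List.Membership.Propositional using (_∈_)
open import Data.List.Relation.Unary.All using (All)
open import Data.List.Relation.Unary.Unique.Propositional using (Unique)
open import Data.List.Relation.Binary.Lex.Strict using (Lex-≤)
open import Data.Nat using (ℕ; _+_; _*_; _∸_; _^_; _<_)
open import Data.Product using (∃-syntax; ∃!; _×_)
open import Relation.Binary.Construct.Closure.ReflexiveTransitive using (Star)
open import Relation.Binary.PropositionalEquality using (_≡_)
open import Relation.Nullary using (¬_)

-- A finite set of natural numbers containing 0, listed without repetition
-- (in arbitrary order), so that |Σ| is the length of the list.
record Alphabet : Set where
  field
    letters  : List ℕ
    distinct : Unique letters
    zero∈    : 0 ∈ letters

open Alphabet public

∣_∣ : Alphabet → ℕ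
∣ S ∣ = length (letters S)

Word : Set
Word = List ℕ

_Over_ : Word → Alphabet → Set
w Over S = All (_∈ letters S) w

_∈_⋆_ : Word → Alphabet → ℕ → Set
u ∈ S ⋆ n = u Over S × length u ≡ n

_≤ₗₑₓ_ : Word → Word → Set
_≤ₗₑₓ_ = Lex-≤ _≡_ _<_

-- AppearsAt m u w i says u = w[im+1..im+n] with n = length u.  If that range
-- overruns w, then take returns fewer than n letters, so for nonempty u the
-- equation also forces im + n ≤ length w.
AppearsAt : ℕ → Word → Word → ℕ → Set
AppearsAt m u w i = take (length u) (drop (i * m) w) ≡ u

Appears : ℕ → Word → Word → Set
Appears m u w = ∃[ i ] AppearsAt m u w i

suffix : ℕ → Word → Word
suffix n w = drop (length w ∸ n) w

-- The length condition is |w| = m|Σ|ⁿ + (n - m), rearranged because n - m may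
-- be negative.
record IsShiftDeBruijn (S : Alphabet) (m n : ℕ) (w : Word) : Set where
  field
    over       : w Over S
    length-eq  : length w + m ≡ m * ∣ S ∣ ^ n + n
    appearOnce : ∀ u → u ∈ S ⋆ n → ∃! _≡_ (AppearsAt m u w)

module Algorithm (S : Alphabet) (m n : ℕ) where

  Admissible : Word → Word → Set
  Admissible w x = x ∈ S ⋆ m × ¬ Appears m (suffix n (w ++ x)) w

  LargestAdmissible : Word → Word → Set
  LargestAdmissible w x = Admissible w x × (∀ y → Admissible w y → y ≤ₗₑₓ x)

  Step : Word → Word → Set
  Step w w′ = ∃[ x ] LargestAdmissible w x × w′ ≡ w ++ x

  Stopped : Word → Set
  Stopped w = ¬ (∃[ x ] Admissible w x)

  Output : Word → Set
  Output w = Star Step (replicate n 0) w × Stopped w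

{-# OPTIONS --safe #-}
module Submission where

-- Put p = min(m, n) and r = n ∸ m, and regard a word of length n = p + r as an
-- edge from its prefix of length r to its suffix of length r.  The successive
-- windows of w then form a trail starting at 0^r.  The algorithm stops only when
-- every edge out of the last vertex has been used; as all in- and out-degrees
-- are |Σ|^p, the trail must be closed, so it is balanced at every vertex and all
-- edges out of 0^r are used.  Elsewhere the edge v 0^p is the last one chosen out
-- of v, so once it is used, so are all edges v x.  If all edges out of its head
-- v′ are used, then by balance all edges into v′ are used, including v 0^p, and
-- hence all edges out of v.  Since the iteration v ↦ v′ shifts in zeros, it
-- reaches 0^r, so every edge is used.

open import Defs
open import Data.List
  using (List; []; _∷_; _++_; length; take; drop; replicate; map; filter; applyDownFrom
        ; cartesianProductWith; [_])
open import Data.List.Membership.Propositional using (_∈_; lose)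
import Data.List.Membership.DecPropositional as DecMembership
open import Data.List.Membership.Propositional.Properties
  using (∈-map⁺; ∈-map⁻; ∈-filter⁺; ∈-filter⁻; ∈-cartesianProductWith⁺
        ; ∈-cartesianProductWith⁻; ∈-applyDownFrom⁺; ∈-applyDownFrom⁻)
open import Data.List.Properties
  using (≡-dec; ∷-injective; length-++; length-map; length-take; length-drop
        ; length-replicate; length-applyDownFrom; take-all; take-take
        ; take++drop≡id; drop-drop; drop-all; take-[]; ++-cancelˡ; ++-assoc
        ; ++-identityʳ; filter-notAll)
open import Data.List.Relation.Binary.Lex.Core using (base; halt; next)
import Data.List.Relation.Binary.Lex.Strict as Lex
open import Data.List.Relation.Binary.Subset.Propositional using (_⊆_)
open import Data.List.Relation.Unary.All as All using (All; []; _∷_)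
import Data.List.Relation.Unary.All.Properties as All
open import Data.List.Relation.Unary.AllPairs using ([]; _∷_)
open import Data.List.Relation.Unary.Any using (here; there)
open import Data.List.Relation.Unary.Unique.Propositional using (Unique)
import Data.List.Relation.Unary.Unique.Propositional.Properties as Unique
open import Data.Nat
  using (ℕ; zero; suc; _+_; _*_; _∸_; _^_; _⊓_; _<_; _≤_; z≤n; s≤s; _≟_; >-nonZero)
open import Data.Nat.Properties
open import Data.Product using (∃; ∃-syntax; ∃!; _×_; _,_; proj₁; proj₂)
open import Data.Sum using (_⊎_; inj₁; inj₂)
open import Function using (_∘_; id)
open import Relation.Binary.Bundles using (DecTotalOrder)
open import Relation.Binary.Construct.Closure.ReflexiveTransitive using (Star; ε; _◅_)
open import Relation.Binary.Definitions using (DecidableEquality)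
open import Relation.Binary.PropositionalEquality
  using (_≡_; _≢_; refl; sym; trans; cong; cong₂; subst; subst₂; module ≡-Reasoning)
open import Relation.Nullary using (¬_; Dec; yes; no; contradiction; ¬?)

private
  variable
    A : Set

infix 4 _≟ʷ_

_≟ʷ_ : DecidableEquality Word
_≟ʷ_ = ≡-dec _≟_

open DecMembership _≟ʷ_ using (_∈?_)

-- Splitting, padding and repetition-free lists.

take-length-++ : (xs : List A) {ys : List A} → take (length xs) (xs ++ ys) ≡ xs
take-length-++ []       = refl
take-length-++ (x ∷ xs) = cong (x ∷_) (take-length-++ xs)

++-injective : (xs ys : List A) {us vs : List A} → length xs ≡ length ys →
               xs ++ us ≡ ys ++ vs → xs ≡ ys × us ≡ vs
++-injective []       []       _  eq = refl , eq
++-injective (x ∷ xs) (y ∷ ys) ls eq with ∷-injective eq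
... | refl , eq′ with ++-injective xs ys (suc-injective ls) eq′
...   | refl , us≡vs = refl , us≡vs

take-++-≤ : ∀ j (xs : List A) {ys} → j ≤ length xs → take j (xs ++ ys) ≡ take j xs
take-++-≤ zero    _        _         = refl
take-++-≤ (suc j) (x ∷ xs) (s≤s j≤l) = cong (x ∷_) (take-++-≤ j xs j≤l)

drop-++-≤ : ∀ j (xs : List A) {ys} → j ≤ length xs → drop j (xs ++ ys) ≡ drop j xs ++ ys
drop-++-≤ zero    _        _         = refl
drop-++-≤ (suc j) (x ∷ xs) (s≤s j≤l) = drop-++-≤ j xs j≤l

-- Either `ys` is empty, or `j` is the full length of `xs ++ ys` and both sides are empty.
drop-pad : ∀ j (xs : List A) {ys} → length ys ≡ j ∸ length xs → drop j (xs ++ ys) ≡ drop j xs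
drop-pad zero    xs       {[]} _  = ++-identityʳ xs
drop-pad zero    []       {_ ∷ _} ()
drop-pad zero    (_ ∷ _)  {_ ∷ _} ()
drop-pad (suc j) []       {ys} eq = drop-all (suc j) ys (≤-reflexive eq)
drop-pad (suc j) (x ∷ xs) eq = drop-pad j xs eq

All-drop-++ : ∀ {P : A → Set} j (xs : List A) {ys} →
              All P (drop j xs) → All P ys → All P (drop j (xs ++ ys))
All-drop-++ zero    xs       pxs pys = All.++⁺ pxs pys
All-drop-++ (suc j) []       pxs pys = All.drop⁺ (suc j) pys
All-drop-++ (suc j) (x ∷ xs) pxs pys = All-drop-++ j xs pxs pys

All≡⇒replicate : ∀ {c : A} {xs} → All (c ≡_) xs → xs ≡ replicate (length xs) c
All≡⇒replicate []           = refl
All≡⇒replicate (refl ∷ pxs) = cong (_ ∷_) (All≡⇒replicate pxs)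

applyDownFrom-cong : ∀ {f g : ℕ → A} K → (∀ {i} → i < K → f i ≡ g i) →
                     applyDownFrom f K ≡ applyDownFrom g K
applyDownFrom-cong zero    eq = refl
applyDownFrom-cong (suc K) eq =
  cong₂ _∷_ (eq ≤-refl) (applyDownFrom-cong K (λ i<K → eq (m<n⇒m<1+n i<K)))

-- Used to turn distinctness of the windows into uniqueness of the position at which a word appears.
Unique-applyDownFrom⁻ : ∀ {f : ℕ → A} {K i j} → Unique (applyDownFrom f K) →
                        i < K → j < K → f i ≡ f j → i ≡ j
Unique-applyDownFrom⁻ {f = f} {suc K} {i} {j} (fK∉ ∷ u) (s≤s i≤K) (s≤s j≤K) eq
  with i ≟ K | j ≟ K
... | yes refl | yes refl = refl
... | yes refl | no  j≢K  = contradiction eq (All.lookup fK∉ (∈-applyDownFrom⁺ f (≤∧≢⇒< j≤K j≢K)))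
... | no  i≢K  | yes refl = contradiction (sym eq) (All.lookup fK∉ (∈-applyDownFrom⁺ f (≤∧≢⇒< i≤K i≢K)))
... | no  i≢K  | no  j≢K  = Unique-applyDownFrom⁻ u (≤∧≢⇒< i≤K i≢K) (≤∧≢⇒< j≤K j≢K) eq

-- Pigeonhole principle for lists.

module _ (_≟ᴬ_ : DecidableEquality A) where

  -- Deleting the head of `xs` from `ys` shortens `ys` and still leaves room for the tail, which
  -- does not contain that head.
  Unique-⊆⇒length-≤ : ∀ {xs ys : List A} → Unique xs → xs ⊆ ys → length xs ≤ length ys
  Unique-⊆⇒length-≤ {[]}     _          _   = z≤n
  Unique-⊆⇒length-≤ {x ∷ xs} {ys} (x∉xs ∷ xs!) sub =
    ≤-<-trans
      (Unique-⊆⇒length-≤ xs! λ {z} z∈xs →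
        ∈-filter⁺ (λ y → ¬? (x ≟ᴬ y)) (sub (there z∈xs)) (All.lookup x∉xs z∈xs))
      (filter-notAll (λ y → ¬? (x ≟ᴬ y)) ys (lose (sub (here refl)) (λ x≢x → x≢x refl)))

  -- A member of `ys` missing from `xs` could be put in front of `xs`, giving a repetition-free list
  -- too long to fit in `ys`.
  Unique-⊆-≥⇒⊇ : ∀ {xs ys : List A} → Unique xs → xs ⊆ ys → length ys ≤ length xs → ys ⊆ xs
  Unique-⊆-≥⇒⊇ {xs} {ys} xs! sub ge {y} y∈ys with DecMembership._∈?_ _≟ᴬ_ y xs
  ... | yes y∈xs = y∈xs
  ... | no  y∉xs = contradiction (Unique-⊆⇒length-≤ y∷xs! y∷xs⊆ys) (<⇒≱ (s≤s ge))
    where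
    y∷xs! : Unique (y ∷ xs)
    y∷xs! = All.tabulate (λ { z∈xs refl → y∉xs z∈xs }) ∷ xs!
    y∷xs⊆ys : (y ∷ xs) ⊆ ys
    y∷xs⊆ys (here refl)  = y∈ys
    y∷xs⊆ys (there z∈xs) = sub z∈xs

-- Enumeration and order of the words of a given length.

module _ (S : Alphabet) where

  words : ℕ → List Word
  words zero    = [ [] ]
  words (suc l) = cartesianProductWith _∷_ (letters S) (words l)

  ∈-words⁺ : ∀ l {u} → u ∈ S ⋆ l → u ∈ words l
  ∈-words⁺ zero    {[]}    _                = here refl
  ∈-words⁺ (suc l) {a ∷ u} (a∈ ∷ u∈ , eq) =
    ∈-cartesianProductWith⁺ _∷_ a∈ (∈-words⁺ l (u∈ , suc-injective eq))

  ∈-words⁻ : ∀ l {u} → u ∈ words l → u ∈ S ⋆ l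
  ∈-words⁻ zero    (here refl) = [] , refl
  ∈-words⁻ (suc l) u∈ with ∈-cartesianProductWith⁻ _∷_ (letters S) (words l) u∈
  ... | a , v , a∈ , v∈ , refl with ∈-words⁻ l v∈
  ...   | v-over , eq = a∈ ∷ v-over , cong suc eq

  words-unique : ∀ l → Unique (words l)
  words-unique zero    = [] ∷ []
  words-unique (suc l) = Unique.cartesianProductWith⁺ _∷_ ∷-injective (distinct S) (words-unique l)

  length-words : ∀ l → length (words l) ≡ ∣ S ∣ ^ l
  length-words zero    = refl
  length-words (suc l) = trans (go (letters S)) (cong (∣ S ∣ *_) (length-words l))
    where
    go : ∀ as → length (cartesianProductWith _∷_ as (words l)) ≡ length as * length (words l)
    go []       = refl
    go (a ∷ as) = trans (length-++ (map (a ∷_) (words l)))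
                        (cong₂ _+_ (length-map (a ∷_) (words l)) (go as))

  zeros∈ : ∀ l → replicate l 0 ∈ S ⋆ l
  zeros∈ l = All.replicate⁺ l (zero∈ S) , length-replicate l

-- At a first difference `y` would need a letter below 0.
≤ₗₑₓ-zeros : ∀ {y} l → length y ≡ l → y ≤ₗₑₓ replicate l 0 → y ≡ replicate l 0
≤ₗₑₓ-zeros zero    eq (base _)      = refl
≤ₗₑₓ-zeros (suc l) () halt
≤ₗₑₓ-zeros (suc l) eq (next refl r) = cong (0 ∷_) (≤ₗₑₓ-zeros l (suc-injective eq) r)

-- Degrees and closed trails.

-- The out-degree of `v` when `f` is the source map, the in-degree when it is the target map. On a
-- singleton it is an indicator.
degree : (Word → Word) → Word → List Word → ℕ
degree f v es = length (filter (λ e → f e ≟ʷ v) es)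

degree-∷ : ∀ f v {e} es → f e ≡ v → degree f v (e ∷ es) ≡ suc (degree f v es)
degree-∷ f v {e} es eq with f e ≟ʷ v
... | yes _  = refl
... | no  ne = contradiction eq ne

degree-∷-≢ : ∀ f v {e} es → f e ≢ v → degree f v (e ∷ es) ≡ degree f v es
degree-∷-≢ f v {e} es ne with f e ≟ʷ v
... | yes eq = contradiction eq ne
... | no  _  = refl

-- The target of each edge is the source of the next, so arrivals at `v` in the first `K` edges are
-- departures in edges 1 to `K`; the start accounts for edge 0.
degree-balance : ∀ (src tgt : Word → Word) (g : ℕ → Word) → (∀ i → tgt (g i) ≡ src (g (suc i))) →
  ∀ v K → degree tgt v (applyDownFrom g K) + degree src v [ g 0 ] ≡ degree src v (applyDownFrom g (suc K))
degree-balance src tgt g walk v zero    = refl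
degree-balance src tgt g walk v (suc K) with src (g (suc K)) ≟ʷ v
... | yes eq = trans (cong (_+ degree src v [ g 0 ]) (degree-∷ tgt v _ (trans (walk K) eq)))
                     (cong suc (degree-balance src tgt g walk v K))
... | no  ne = trans (cong (_+ degree src v [ g 0 ]) (degree-∷-≢ tgt v _ (ne ∘ trans (sym (walk K)))))
                     (degree-balance src tgt g walk v K)

-- The trail consists of `g 0` to `g k`. Of `g (suc k)` only the source matters: it is the vertex
-- where the trail ends.
module ClosedWalk
  (S : Alphabet) (m n : ℕ) (0<m : 0 < m) (g : ℕ → Word) (k : ℕ)
  where

  E : List Word
  E = applyDownFrom g (suc k)

  -- With these truncations `p + r` is `n` even when `m` exceeds `n`; then the empty word is the
  -- only vertex and all edges are loops.
  p r : ℕ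
  p = m ⊓ n
  r = n ∸ m

  src tgt : Word → Word
  src = take r
  tgt = drop m

  Saturated : Word → Set
  Saturated v = ∀ {x} → x ∈ S ⋆ p → v ++ x ∈ E

  module _
    (over   : ∀ {e} → e ∈ E → e ∈ S ⋆ n)
    (E!     : Unique E)
    (walk   : ∀ i → tgt (g i) ≡ src (g (suc i)))
    (start  : src (g 0) ≡ replicate r 0)
    (finish : Saturated (src (g (suc k))))
    (greedy : ∀ {v} → v ∈ S ⋆ r → v ≢ replicate r 0 → v ++ replicate p 0 ∈ E → Saturated v)
    where

    -- The common in- and out-degree of all vertices in the full graph.
    N : ℕ
    N = length (words S p)

    outdeg indeg : Word → ℕ
    outdeg v = degree src v E
    indeg v = degree tgt v E

    tgt∈ : ∀ {e} → e ∈ S ⋆ n → tgt e ∈ S ⋆ r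
    tgt∈ {e} (e-over , refl) = All.drop⁺ m e-over , length-drop m e

    head∈ : ∀ {e} → e ∈ S ⋆ n → take m e ∈ S ⋆ p
    head∈ {e} (e-over , refl) = All.take⁺ m e-over , length-take m e

    ++∈ : ∀ {v} → v ∈ S ⋆ r → ∀ {x} → x ∈ S ⋆ p → (v ++ x) ∈ S ⋆ n
    ++∈ {v} (v-over , lv) (x-over , lx) = All.++⁺ v-over x-over ,
      trans (length-++ v) (trans (cong₂ _+_ lv lx) (trans (+-comm r p) (m⊓n+n∸m≡n m n)))

    Saturated⇒N≤out : ∀ {v} → v ∈ S ⋆ r → Saturated v → N ≤ outdeg v
    Saturated⇒N≤out {v} (_ , lv) sat = subst (_≤ outdeg v) (length-map (v ++_) (words S p))
      (Unique-⊆⇒length-≤ _≟ʷ_ (Unique.map⁺ (++-cancelˡ v _ _) (words-unique S p)) sub)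
      where
      sub : map (v ++_) (words S p) ⊆ filter (λ e → src e ≟ʷ v) E
      sub e∈ with ∈-map⁻ (v ++_) e∈
      ... | x , x∈ , refl = ∈-filter⁺ (λ e → src e ≟ʷ v) (sat (∈-words⁻ S p x∈))
        (subst (λ l → take l (v ++ x) ≡ v) lv (take-length-++ v))

    in-edges⊆ : ∀ v → filter (λ e → tgt e ≟ʷ v) E ⊆ map (_++ v) (words S p)
    in-edges⊆ v {e} e∈ with ∈-filter⁻ (λ e → tgt e ≟ʷ v) {xs = E} e∈
    ... | e∈E , refl = subst (_∈ map (_++ tgt e) (words S p)) (take++drop≡id m e)
      (∈-map⁺ (_++ tgt e) (∈-words⁺ S p (head∈ (over e∈E))))

    in-edges! : ∀ v → Unique (filter (λ e → tgt e ≟ʷ v) E)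
    in-edges! v = Unique.filter⁺ (λ e → tgt e ≟ʷ v) E!

    in≤N : ∀ v → indeg v ≤ N
    in≤N v = subst (indeg v ≤_) (length-map (_++ v) (words S p))
      (Unique-⊆⇒length-≤ _≟ʷ_ (in-edges! v) (in-edges⊆ v))

    -- Only `N` edges into `v` exist, so a trail using `N` of them uses all.
    N≤in⇒in-edge : ∀ v → N ≤ indeg v → ∀ {y} → y ∈ S ⋆ p → y ++ v ∈ E
    N≤in⇒in-edge v N≤in y∈ = proj₁ (∈-filter⁻ (λ e → tgt e ≟ʷ v) {xs = E}
      (Unique-⊆-≥⇒⊇ _≟ʷ_ (in-edges! v) (in-edges⊆ v)
        (subst (_≤ indeg v) (sym (length-map (_++ v) (words S p))) N≤in)
        (∈-map⁺ (_++ v) (∈-words⁺ S p y∈))))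

    balance : ∀ v → indeg v + degree src v [ g 0 ] ≡ degree src v (g (suc k) ∷ E)
    balance v = degree-balance src tgt g walk v (suc k)

    last∈E : g k ∈ E
    last∈E = here refl

    end∈ : src (g (suc k)) ∈ S ⋆ r
    end∈ = subst (_∈ S ⋆ r) (walk k) (tgt∈ (over last∈E))

    -- Otherwise the end would have one more in-edge than its N out-edges.
    closed : src (g (suc k)) ≡ src (g 0)
    closed with src (g 0) ≟ʷ src (g (suc k))
    ... | yes eq = sym eq
    ... | no  ne = contradiction (in≤N v) (<⇒≱ N<in)
      where
      v = src (g (suc k))
      in≡1+out : indeg v ≡ suc (outdeg v)
      in≡1+out = trans (sym (+-identityʳ _))
        (trans (cong (indeg v +_) (sym (degree-∷-≢ src v [] ne)))
        (trans (balance v) (degree-∷ src v E refl)))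
      N<in : N < indeg v
      N<in = subst (N <_) (sym in≡1+out) (s≤s (Saturated⇒N≤out end∈ finish))

    -- In `balance` the extra terms for the start and the end of the trail cancel, because the two
    -- vertices coincide.
    in≡out : ∀ v → indeg v ≡ outdeg v
    in≡out v with balance v | src (g 0) ≟ʷ v
    ... | bal | yes eq = suc-injective (trans (sym (+-comm (indeg v) 1))
      (trans (cong (indeg v +_) (sym (degree-∷ src v [] eq)))
      (trans bal (degree-∷ src v E (trans closed eq)))))
    ... | bal | no  ne = trans (sym (+-identityʳ _))
      (trans (cong (indeg v +_) (sym (degree-∷-≢ src v [] ne)))
      (trans bal (degree-∷-≢ src v E (ne ∘ trans (sym closed)))))

    zeros-saturated : Saturated (replicate r 0)
    zeros-saturated = subst Saturated (trans closed start) finish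

    -- By balance all `N` edges into the head of `v 0^p` are used. That edge is one of them, and
    -- `greedy` gives the others out of `v`.
    saturated-pred : ∀ {v} → v ∈ S ⋆ r → v ≢ replicate r 0 →
                     Saturated (tgt (v ++ replicate p 0)) → Saturated v
    saturated-pred {v} v∈ v≢0 sat = greedy v∈ v≢0
      (subst (_∈ E) (take++drop≡id m e)
        (N≤in⇒in-edge (tgt e)
          (subst (N ≤_) (sym (in≡out (tgt e))) (Saturated⇒N≤out (tgt∈ e∈) sat))
          (head∈ e∈)))
      where
      e = v ++ replicate p 0
      e∈ = ++∈ v∈ (zeros∈ S p)

    -- Induction on a bound `j` for the part of `v` before its final zeros. Following the zero edge
    -- shifts this part left by `m`, which is at least 1.
    saturated-from : ∀ j {v} → v ∈ S ⋆ r → All (0 ≡_) (drop j v) → Saturated v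
    saturated-from j {v} v∈ z with v ≟ʷ replicate r 0
    ... | yes refl = zeros-saturated
    saturated-from zero {v} v∈ z | no v≢0 =
      contradiction (trans (All≡⇒replicate z) (cong (λ l → replicate l 0) (proj₂ v∈))) v≢0
    saturated-from (suc j) {v} v∈ z | no v≢0 =
      saturated-pred v∈ v≢0 (saturated-from j (tgt∈ (++∈ v∈ (zeros∈ S p))) (shift 0<m))
      where
      e = v ++ replicate p 0
      -- One of the `m` dropped letters lowers `j` by one; the remaining `m′` are dropped from a
      -- tail already known to be zero.
      shift : ∀ {m} → 0 < m → All (0 ≡_) (drop j (drop m e))
      shift {suc m′} _ = subst (All (0 ≡_))
        (trans (drop-drop (suc j) m′ e)
        (trans (cong (λ l → drop (suc l) e) (+-comm j m′))
               (sym (drop-drop (suc m′) j e))))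
        (All.drop⁺ m′ (All-drop-++ (suc j) v z (All.replicate⁺ p refl)))

    all-saturated : ∀ {v} → v ∈ S ⋆ r → Saturated v
    all-saturated {v} v∈ = saturated-from (length v) v∈
      (subst (All (0 ≡_)) (sym (drop-all (length v) v ≤-refl)) [])

    complete : ∀ {u} → u ∈ S ⋆ n → u ∈ E
    complete {u} (u-over , lu) = subst (_∈ E) (take++drop≡id r u)
      (all-saturated
        (All.take⁺ r u-over , trans (length-take r u) (m≤n⇒m⊓n≡m (subst (r ≤_) (sym lu) (m∸n≤m n m))))
        (All.drop⁺ r u-over , trans (length-drop r u) (trans (cong (_∸ r) lu) n∸r≡p)))
      where
      n∸r≡p : n ∸ r ≡ p
      n∸r≡p = trans (cong (_∸ r) (sym (m⊓n+n∸m≡n m n))) (m+n∸n≡m p r)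

-- Windows at modulo m positions.

module _ (S : Alphabet) (m n : ℕ) (0<m : 0 < m) (0<n : 0 < n) where

  open Algorithm S m n

  p r : ℕ
  p = m ⊓ n
  r = n ∸ m

  -- If `w` has length `k * m + n`, the window at `suc k` is cut short to the last `r` letters of
  -- `w`, the end vertex of the trail.
  window : Word → ℕ → Word
  window w i = take n (drop (i * m) w)

  windows : Word → ℕ → List Word
  windows w k = applyDownFrom (window w) (suc k)

  -- Both sides are the up to `n ∸ m` letters from offset `suc i * m` on. No bound on `i` is
  -- assumed, so the cut-off window after the last is covered too.
  window-walk : ∀ w i → drop m (window w i) ≡ take r (window w (suc i))
  window-walk w i = begin
    drop m (take n ys)             ≡⟨ drop-take m n ys ⟩
    take r (drop m ys)             ≡⟨ cong (take r) (trans (drop-drop (i * m) m w) (cong (λ l → drop l w) (+-comm (i * m) m))) ⟩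
    take r zs                      ≡⟨ cong (λ l → take l zs) (m≤n⇒m⊓n≡m (m∸n≤m n m)) ⟨
    take (r ⊓ n) zs                ≡⟨ take-take r n zs ⟨
    take r (take n zs)             ∎
    where
    open ≡-Reasoning
    ys = drop (i * m) w
    zs = drop (suc i * m) w
    drop-take : ∀ j l (xs : Word) → drop j (take l xs) ≡ take (l ∸ j) (drop j xs)
    drop-take zero    l       xs       = refl
    drop-take (suc j) zero    xs       = refl
    drop-take (suc j) (suc l) []       = sym (take-[] (l ∸ j))
    drop-take (suc j) (suc l) (x ∷ xs) = drop-take j l xs

  window-++ : ∀ w {x} i → i * m + n ≤ length w → window (w ++ x) i ≡ window w i
  window-++ w {x} i le = begin
    take n (drop (i * m) (w ++ x))  ≡⟨ cong (take n) (drop-++-≤ (i * m) w (m+n≤o⇒m≤o (i * m) le)) ⟩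
    take n (drop (i * m) w ++ x)    ≡⟨ take-++-≤ n (drop (i * m) w) (subst (n ≤_) (sym (length-drop (i * m) w)) (m+n≤o⇒n≤o∸m (i * m) le)) ⟩
    take n (drop (i * m) w)         ∎
    where
    open ≡-Reasoning
    m+n≤o⇒n≤o∸m : ∀ a {b c} → a + b ≤ c → b ≤ c ∸ a
    m+n≤o⇒n≤o∸m a {b} {c} le = m+n≤o⇒m≤o∸n b (subst (_≤ c) (+-comm a b) le)

  module _ (w : Word) (k : ℕ) (lw : length w ≡ k * m + n) where

    n≤length : n ≤ length w
    n≤length = subst (n ≤_) (sym lw) (m≤n+m n (k * m))

    suffix-drop : suffix n w ≡ drop (k * m) w
    suffix-drop = cong (λ l → drop l w) (trans (cong (_∸ n) lw) (m+n∸n≡m (k * m) n))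

    length-suffix : length (suffix n w) ≡ n
    length-suffix = trans (length-drop (length w ∸ n) w) (m∸[m∸n]≡n n≤length)

    last-window : window w k ≡ suffix n w
    last-window = trans (cong (take n) (sym suffix-drop))
                        (take-all n (suffix n w) (≤-reflexive length-suffix))

    length-step : ∀ {x} → length x ≡ m → length (w ++ x) ≡ suc k * m + n
    length-step {x} lx = begin
      length (w ++ x)      ≡⟨ length-++ w ⟩
      length w + length x  ≡⟨ cong₂ _+_ lw lx ⟩
      k * m + n + m        ≡⟨ +-comm (k * m + n) m ⟩
      m + (k * m + n)      ≡⟨ +-assoc m (k * m) n ⟨
      suc k * m + n        ∎
      where open ≡-Reasoning

    windows-++ : ∀ x → applyDownFrom (window (w ++ x)) (suc k) ≡ windows w k
    windows-++ x = applyDownFrom-cong (suc k) λ { {i} (s≤s i≤k) →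
      window-++ w i (subst (i * m + n ≤_) (sym lw) (+-monoˡ-≤ n (*-monoˡ-≤ m i≤k))) }

  suffix-++ : ∀ {w x} k → length w ≡ k * m + n → length x ≡ m →
              suffix n (w ++ x) ≡ drop m (suffix n w ++ x)
  suffix-++ {w} {x} k lw lx = begin
    suffix n (w ++ x)                ≡⟨ suffix-drop (w ++ x) (suc k) (length-step w k lw lx) ⟩
    drop (m + k * m) (w ++ x)        ≡⟨ cong (λ l → drop l (w ++ x)) (+-comm m (k * m)) ⟩
    drop (k * m + m) (w ++ x)        ≡⟨ drop-drop (k * m) m (w ++ x) ⟨
    drop m (drop (k * m) (w ++ x))   ≡⟨ cong (drop m) (drop-++-≤ (k * m) w (subst (k * m ≤_) (sym lw) (m≤m+n (k * m) n))) ⟩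
    drop m (drop (k * m) w ++ x)     ≡⟨ cong (λ e → drop m (e ++ x)) (suffix-drop w k lw) ⟨
    drop m (suffix n w ++ x)         ∎
    where open ≡-Reasoning

  length-pad : ∀ (z : Word) {x : Word} → length z ≡ m ∸ n → length x ≡ p → length (z ++ x) ≡ m
  length-pad z {x} lz lx = begin
    length (z ++ x)      ≡⟨ length-++ z ⟩
    length z + length x  ≡⟨ cong₂ _+_ lz (trans lx (⊓-comm m n)) ⟩
    m ∸ n + n ⊓ m        ≡⟨ +-comm (m ∸ n) (n ⊓ m) ⟩
    n ⊓ m + (m ∸ n)      ≡⟨ m⊓n+n∸m≡n n m ⟩
    m                    ∎
    where open ≡-Reasoning

  -- When `m` exceeds `n`, the next window skips the first `m ∸ n` letters of the appended block.
  -- They are split off as `z`, and `x` alone selects the edge.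
  suffix-++-pad : ∀ {w z x} k → length w ≡ k * m + n → length z ≡ m ∸ n → length x ≡ p →
                  suffix n (w ++ z ++ x) ≡ drop m (suffix n w) ++ x
  suffix-++-pad {w} {z} {x} k lw lz lx = begin
    suffix n (w ++ z ++ x)           ≡⟨ suffix-++ k lw lzx ⟩
    drop m (e ++ z ++ x)             ≡⟨ cong (drop m) (++-assoc e z x) ⟨
    drop m ((e ++ z) ++ x)           ≡⟨ drop-++-≤ m (e ++ z) m≤ ⟩
    drop m (e ++ z) ++ x             ≡⟨ cong (_++ x) (drop-pad m e (trans lz (cong (m ∸_) (sym le)))) ⟩
    drop m e ++ x                    ∎
    where
    open ≡-Reasoning
    e = suffix n w
    le : length e ≡ n
    le = length-suffix w k lw
    lzx : length (z ++ x) ≡ m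
    lzx = length-pad z lz lx
    m≤ : m ≤ length (e ++ z)
    m≤ = subst (m ≤_) (sym (trans (length-++ e) (cong₂ _+_ le lz))) (m≤n+m∸n m n)

  -- A match has all `n` letters, so it must end within `w`.
  appearsAt⇒≤ : ∀ {w u i} k → length w ≡ k * m + n → length u ≡ n → AppearsAt m u w i → i ≤ k
  appearsAt⇒≤ {w} {u} {i} k lw refl at =
    *-cancelʳ-≤ i k m ⦃ >-nonZero 0<m ⦄ (+-cancelʳ-≤ n (i * m) (k * m) im+n≤)
    where
    n≤ : n ≤ length w ∸ i * m
    n≤ = subst (n ≤_) (length-drop (i * m) w)
      (m⊓n≡m⇒m≤n (trans (sym (length-take n (drop (i * m) w))) (cong length at)))
    im≤len : i * m ≤ length w
    -- As `n` is positive, the truncated difference is nonzero, so the offset lies inside `w`.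
    im≤len = <⇒≤ (m∸n≢0⇒n<m {length w} {i * m} (λ eq → <⇒≢ (<-≤-trans 0<n n≤) (sym eq)))
    im+n≤ : i * m + n ≤ k * m + n
    im+n≤ = subst₂ _≤_ (+-comm n (i * m)) lw (m≤o∸n⇒m+n≤o n im≤len n≤)

  appears⇒∈windows : ∀ {w u} k → length w ≡ k * m + n → length u ≡ n →
                     Appears m u w → u ∈ windows w k
  appears⇒∈windows {w} k lw refl (i , at) =
    subst (_∈ windows w k) at (∈-applyDownFrom⁺ (window w) (s≤s (appearsAt⇒≤ {i = i} k lw refl at)))

  ∈windows⇒appears : ∀ {w u} k → length u ≡ n → u ∈ windows w k → Appears m u w
  ∈windows⇒appears {w} k refl u∈ with ∈-applyDownFrom⁻ (window w) u∈
  ... | i , _ , eq = i , sym eq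

  -- Invariant of the algorithm.

  -- Here `k` counts the appended blocks. The field `greedy` says that the zero edge is the last one
  -- taken out of `v`. The vertex `0^r` is exempt: its zero edge is the initial window, which was
  -- not chosen.
  record Invariant (w : Word) (k : ℕ) : Set where
    field
      over   : w Over S
      len    : length w ≡ k * m + n
      start  : window w 0 ≡ replicate n 0
      fresh  : Unique (windows w k)
      greedy : ∀ {v x} → v ∈ S ⋆ r → v ≢ replicate r 0 → x ∈ S ⋆ p →
               v ++ replicate p 0 ∈ windows w k → v ++ x ∈ windows w k

    window∈ : ∀ {e} → e ∈ windows w k → e ∈ S ⋆ n
    window∈ e∈ with ∈-applyDownFrom⁻ (window w) e∈
    ... | i , s≤s i≤k , refl = All.take⁺ n (All.drop⁺ (i * m) over) ,
      trans (length-take n (drop (i * m) w)) (m≤n⇒m⊓n≡m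
        (subst (n ≤_) (sym (length-drop (i * m) w)) (m+n≤o⇒m≤o∸n n
          (subst₂ _≤_ (+-comm (i * m) n) (sym len) (+-monoˡ-≤ n (*-monoˡ-≤ m i≤k))))))

    -- The windows are distinct words of length `n`. This bounds the number of steps.
    1+k≤ : suc k ≤ ∣ S ∣ ^ n
    1+k≤ = subst₂ _≤_ (length-applyDownFrom (window w) (suc k)) (length-words S n)
      (Unique-⊆⇒length-≤ _≟ʷ_ fresh (λ e∈ → ∈-words⁺ S n (window∈ e∈)))

  zeros-prefix : ∀ {v x} → v ∈ S ⋆ r → v ++ x ≡ replicate n 0 → v ≡ replicate r 0
  zeros-prefix {v} (_ , lv) eq = trans
    (All≡⇒replicate (All.++⁻ˡ v (subst (All (0 ≡_)) (sym eq) (All.replicate⁺ n refl))))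
    (cong (λ l → replicate l 0) lv)

  initial : Invariant (replicate n 0) 0
  initial = record
    { over   = proj₁ (zeros∈ S n)
    ; len    = length-replicate n
    ; start  = w₀
    ; fresh  = [] ∷ []
    ; greedy = λ { v∈ v≢0 _ (here eq) → contradiction (zeros-prefix v∈ (trans eq w₀)) v≢0 }
    }
    where
    w₀ : take n (replicate n 0) ≡ replicate n 0
    w₀ = take-all n (replicate n 0) (≤-reflexive (length-replicate n))

  -- For `n ≤ m` the only vertex is the empty word, which is `0^r`.
  r≢0⇒m≤n : ∀ {v} → v ∈ S ⋆ r → v ≢ replicate r 0 → m ≤ n
  r≢0⇒m≤n {v} (_ , lv) v≢0 with ≤-total m n
  ... | inj₁ m≤n = m≤n
  ... | inj₂ n≤m = contradiction (short v lv (m≤n⇒m∸n≡0 n≤m)) v≢0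
    where
    short : ∀ {l} (v : Word) → length v ≡ l → l ≡ 0 → v ≡ replicate l 0
    short [] refl refl = refl

  module _ {w : Word} {k : ℕ} (inv : Invariant w k) where
    open Invariant inv

    length-new : ∀ {x} → length x ≡ m → length (suffix n (w ++ x)) ≡ n
    length-new {x} lx = length-suffix (w ++ x) (suc k) (length-step w k len lx)

    -- Deciding membership in the list of windows removes the double negation left by a refuted
    -- `Admissible`.
    visited : ∀ {x} → x ∈ S ⋆ m → ¬ Admissible w x → suffix n (w ++ x) ∈ windows w k
    visited {x} x∈ ¬adm with suffix n (w ++ x) ∈? windows w k
    ... | yes e∈ = e∈
    ... | no  e∉ = contradiction
      (x∈ , λ a → e∉ (appears⇒∈windows k len (length-new (proj₂ x∈)) a)) ¬adm

    step : ∀ {x} → LargestAdmissible w x → Invariant (w ++ x) (suc k)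
    step {x} ((x∈@(x-over , lx) , new) , largest) = record
      { over   = All.++⁺ over x-over
      ; len    = len′
      ; start  = trans (window-++ w 0 (n≤length w k len)) start
      ; fresh  = subst Unique (sym windows′)
          (All.tabulate (λ { e∈ refl → new (∈windows⇒appears k (length-new lx) e∈) }) ∷ fresh)
      ; greedy = λ {v} {y} v∈ v≢0 y∈ → subst (λ E → v ++ replicate p 0 ∈ E → v ++ y ∈ E)
          (sym windows′) (greedy′ v∈ v≢0 y∈)
      }
      where
      len′ : length (w ++ x) ≡ suc k * m + n
      len′ = length-step w k len lx

      windows′ : windows (w ++ x) (suc k) ≡ suffix n (w ++ x) ∷ windows w k
      windows′ = cong₂ _∷_ (last-window (w ++ x) (suc k) len′) (windows-++ w k len x)

      greedy′ : ∀ {v y} → v ∈ S ⋆ r → v ≢ replicate r 0 → y ∈ S ⋆ p →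
                v ++ replicate p 0 ∈ suffix n (w ++ x) ∷ windows w k →
                v ++ y ∈ suffix n (w ++ x) ∷ windows w k
      greedy′ v∈ v≢0 y∈ (there e∈) = there (greedy v∈ v≢0 y∈ e∈)
      greedy′ {v} {y} v∈ v≢0 y∈ (here eq) with v ++ y ∈? windows w k
      ... | yes e∈ = there e∈
      ... | no  e∉ = here (trans (sym (new-window y∈)) (cong (λ z → suffix n (w ++ z)) y≡x))
        where
        m≤n : m ≤ n
        m≤n = r≢0⇒m≤n v∈ v≢0

        p≡m : p ≡ m
        p≡m = m≤n⇒m⊓n≡m m≤n

        x∈p : x ∈ S ⋆ p
        x∈p = subst (x ∈ S ⋆_) (sym p≡m) x∈

        append : ∀ {z} → z ∈ S ⋆ p → suffix n (w ++ z) ≡ drop m (suffix n w) ++ z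
        append (_ , lz) = suffix-++-pad {z = []} k len (sym (m≤n⇒m∸n≡0 m≤n)) lz

        split : v ≡ drop m (suffix n w) × replicate p 0 ≡ x
        split = ++-injective v (drop m (suffix n w))
          (trans (proj₂ v∈) (sym (trans (length-drop m (suffix n w)) (cong (_∸ m) (length-suffix w k len)))))
          (trans eq (append x∈p))

        new-window : ∀ {z} → z ∈ S ⋆ p → suffix n (w ++ z) ≡ v ++ z
        new-window z∈ = trans (append z∈) (cong (_++ _) (sym (proj₁ split)))

        y∈m : y ∈ S ⋆ m
        y∈m = subst (y ∈ S ⋆_) p≡m y∈

        y≤0 : y ≤ₗₑₓ replicate p 0
        y≤0 = subst (y ≤ₗₑₓ_) (sym (proj₂ split)) (largest y (y∈m , λ a →
          e∉ (subst (_∈ windows w k) (new-window y∈)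
               (appears⇒∈windows k len (length-new (proj₂ y∈m)) a))))

        y≡x : y ≡ x
        y≡x = trans (≤ₗₑₓ-zeros p (proj₂ y∈) y≤0) (proj₂ split)

    stuck⇒complete : Stopped w → ∀ {u} → u ∈ S ⋆ n → u ∈ windows w k
    stuck⇒complete stop = ClosedWalk.complete S m n 0<m (window w) k
      window∈ fresh (window-walk w) start-vertex finish
      (λ v∈ v≢0 e∈ x∈ → greedy v∈ v≢0 x∈ e∈)
      where
      start-vertex : take r (window w 0) ≡ replicate r 0
      start-vertex = zeros-prefix
        (All.take⁺ r (proj₁ w₀∈) , trans (length-take r _) (m≤n⇒m⊓n≡m (subst (r ≤_) (sym (proj₂ w₀∈)) (m∸n≤m n m))))
        (trans (take++drop≡id r (window w 0)) start)
        where
        w₀∈ : window w 0 ∈ S ⋆ n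
        w₀∈ = window∈ (∈-applyDownFrom⁺ (window w) (s≤s z≤n))

      -- Each edge out of the end vertex arises from a full block, obtained by padding `x` in front
      -- with `m ∸ n` zeros. Since the algorithm has stopped, that edge was visited.
      finish : ∀ {x} → x ∈ S ⋆ p → take r (window w (suc k)) ++ x ∈ windows w k
      finish {x} (x-over , lx) = subst (_∈ windows w k)
        (trans (suffix-++-pad k len (length-replicate (m ∸ n)) lx)
               (cong (_++ x) (trans (cong (drop m) (sym (last-window w k len))) (window-walk w k))))
        (visited {z ++ x}
          (All.++⁺ (proj₁ (zeros∈ S (m ∸ n))) x-over , length-pad z (length-replicate (m ∸ n)) lx)
          (λ adm → stop (_ , adm)))
        where
        z = replicate (m ∸ n) 0

    stuck⇒deBruijn : Stopped w → IsShiftDeBruijn S m n w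
    stuck⇒deBruijn stop = record
      { over       = over
      ; length-eq  = length-eq
      ; appearOnce = once
      }
      where
      complete : ∀ {u} → u ∈ S ⋆ n → u ∈ windows w k
      complete = stuck⇒complete stop

      1+k≡ : suc k ≡ ∣ S ∣ ^ n
      1+k≡ = ≤-antisym 1+k≤ (subst₂ _≤_ (length-words S n) (length-applyDownFrom (window w) (suc k))
        (Unique-⊆⇒length-≤ _≟ʷ_ (words-unique S n) (λ u∈ → complete (∈-words⁻ S n u∈))))

      length-eq : length w + m ≡ m * ∣ S ∣ ^ n + n
      length-eq = begin
        length w + m          ≡⟨ cong (_+ m) len ⟩
        k * m + n + m         ≡⟨ +-comm (k * m + n) m ⟩
        m + (k * m + n)       ≡⟨ +-assoc m (k * m) n ⟨
        suc k * m + n         ≡⟨ cong (_+ n) (*-comm (suc k) m) ⟩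
        m * suc k + n         ≡⟨ cong (λ l → m * l + n) 1+k≡ ⟩
        m * ∣ S ∣ ^ n + n     ∎
        where open ≡-Reasoning

      once : ∀ u → u ∈ S ⋆ n → ∃! _≡_ (AppearsAt m u w)
      once u u∈@(_ , refl) with ∈windows⇒appears k refl (complete u∈)
      ... | i , at = i , at , λ {j} at′ → Unique-applyDownFrom⁻ fresh
        (s≤s (appearsAt⇒≤ {i = i} k len refl at)) (s≤s (appearsAt⇒≤ {i = j} k len refl at′))
        (trans at (sym at′))

    -- The admissible blocks form a finite list; if it is nonempty, it has a maximum in the total
    -- lexicographic order.
    progress : Stopped w ⊎ ∃[ x ] LargestAdmissible w x
    progress = search (filter fresh? (words S m)) refl
      where
      open import Data.List.Extrema (DecTotalOrder.totalOrder (Lex.≤-decTotalOrder <-strictTotalOrder))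

      fresh? : (x : Word) → Dec (¬ (suffix n (w ++ x) ∈ windows w k))
      fresh? x = ¬? (suffix n (w ++ x) ∈? windows w k)

      candidate⁺ : ∀ {x} → Admissible w x → x ∈ filter fresh? (words S m)
      candidate⁺ (x∈ , new) = ∈-filter⁺ fresh? (∈-words⁺ S m x∈)
        (λ e∈ → new (∈windows⇒appears k (length-new (proj₂ x∈)) e∈))

      candidate⁻ : ∀ {x} → x ∈ filter fresh? (words S m) → Admissible w x
      candidate⁻ c with ∈-filter⁻ fresh? {xs = words S m} c
      ... | x∈ws , e∉ with ∈-words⁻ S m x∈ws
      ...   | x∈ = x∈ , λ a → e∉ (appears⇒∈windows k len (length-new (proj₂ x∈)) a)

      search : ∀ cs → filter fresh? (words S m) ≡ cs → Stopped w ⊎ ∃[ x ] LargestAdmissible w x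
      search []       eq = inj₁ λ (x , adm) → contradiction (subst (x ∈_) eq (candidate⁺ adm)) λ ()
      -- The head `c` serves as the default value of `max`, so the maximum is itself a candidate.
      search (c ∷ cs) eq = inj₂ (max c cs ,
        All.lookup admissible (max∈ c cs) ,
        λ y adm → largest (subst (y ∈_) eq (candidate⁺ adm)))
        where
        admissible : All (Admissible w) (c ∷ cs)
        admissible = All.tabulate (λ x∈ → candidate⁻ (subst (_ ∈_) (sym eq) x∈))

        max∈ : ∀ c cs → max c cs ∈ c ∷ cs
        max∈ c cs = argmax-all id {P = _∈ c ∷ cs} (here refl) (All.tabulate there)

        largest : ∀ {y} → y ∈ c ∷ cs → y ≤ₗₑₓ max c cs
        largest (here refl) = ⊥≤max c cs
        largest (there y∈)  = All.lookup (xs≤max c cs) y∈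

  -- Termination and correctness.

  reachable : ∀ {w w′ k} → Invariant w k → Star Step w w′ → ∃[ k′ ] Invariant w′ k′
  reachable inv ε                        = _ , inv
  reachable inv ((x , largest , refl) ◅ s) = reachable (step inv largest) s

  -- Each step raises `k` and spends one unit of fuel; running out would contradict the bound on the
  -- number of windows.
  terminates : ∀ fuel {w k} → ∣ S ∣ ^ n ≤ fuel + k → Invariant w k → ∃[ w′ ] Star Step w w′ × Stopped w′
  terminates zero       le inv = contradiction (≤-trans (Invariant.1+k≤ inv) le) 1+n≰n
  terminates (suc fuel) {w} {k} le inv with progress inv
  ... | inj₁ stop          = w , ε , stop
  ... | inj₂ (x , largest) with terminates fuel (subst (∣ S ∣ ^ n ≤_) (sym (+-suc fuel k)) le) (step inv largest)
  ...   | w′ , s , stop = w′ , (x , largest , refl) ◅ s , stop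

mainTheorem4 : (S : Alphabet) (m n : ℕ) → 0 < m → 0 < n →
    ∃ (Algorithm.Output S m n) ×
    (∀ w → Algorithm.Output S m n w → IsShiftDeBruijn S m n w)
mainTheorem4 S m n 0<m 0<n =
  terminates S m n 0<m 0<n (∣ S ∣ ^ n) (m≤m+n _ 0) (initial S m n 0<m 0<n) ,
  λ w (steps , stop) →
    stuck⇒deBruijn S m n 0<m 0<n (proj₂ (reachable S m n 0<m 0<n (initial S m n 0<m 0<n) steps)) stop
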